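{- For every $k \in \{1,2,3,4,5\}$ we have $\mathrm{minvdeg}(\mathcal{MU}_{\delta=k}) = \mathrm{minvdeg}(\mathcal{UHIT}_{\delta=k}) = \mathrm{N}(k)$.
   Context: Literals come with a fixed-point-free involution $x \mapsto \overline{x}$; variables are positive literals. A clause is a finite set $C$ of literals with $C \cap \overline{C} = \emptyset$; a clause-set is a finite set of clauses. $\mathrm{var}(F)$, $n(F) = |\mathrm{var}(F)|$, $c(F) = |F|$, $\delta(F) = c(F) - n(F)$. $\mathcal{MU}$ is the class of minimally unsatisfiable clause-sets (unsatisfiable, but removing any clause gives a satisfiable clause-set). $F$ is hitting if for all distinct $C, D \in F$, $C \cap \overline{D} \ne \emptyset$; $\mathcal{UHIT}$ is the class of unsatisfiable hitting clause-sets. $\mathcal{C}_{\delta=k} = \{F \in \mathcal{C} : \delta(F) = k\}$. $\mathrm{ld}_F(x)$ is the number of clauses containing $x$, $\mathrm{vdeg}_F(v) = \mathrm{ld}_F(v)+\mathrm{ld}_F(\overline{v})$, $\mathrm{minvdeg}(F) = \min_{v \in \mathrm{var}(F)} \mathrm{vdeg}_F(v)$; for a class $\mathcal{D}$, $\mathrm{minvdeg}(\mathcal{D})$ is the supremum of $\mathrm{minvdeg}(F)$ over $F \in \mathcal{D}$ with $n(F) > 0$. $\mathrm{N}(1) = 2$, $\mathrm{N}(k) = \max_{i \in \{2,\dots,k\}} \min(2i, \mathrm{N}(k-i+1)+i)$ for $k \ge 2$. -}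

module Defs where

open import Data.Bool.Base using (Bool; true; not)
open import Data.Integer.Base as ℤ using (ℤ; +_)
open import Data.List.Base using (List; []; _∷_; length; map; concatMap; filter; deduplicate; upTo)
open import Data.List.Extrema.Nat using (min; max)
open import Data.List.Membership.Propositional using (_∈_; _∉_)
open import Data.List.Relation.Binary.BagAndSetEquality using (set; [_]-Equality)
open import Data.List.Relation.Unary.All using (All)
open import Data.List.Relation.Unary.Any using (Any; _─_)
open import Data.List.Relation.Unary.Unique.Setoid using (Unique)
open import Data.Nat.Base using (ℕ; zero; suc; _+_; _*_; _∸_; _⊓_; _≤_; _<_; s≤s)
open import Data.Nat.Induction using (Acc; acc; <-wellFounded)
open import Data.Nat.Properties using (m∸n≤m)
import Data.Nat.Properties as ℕ
open import Data.Product.Base using (∃-syntax; _×_)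
open import Level using (0ℓ)
open import Relation.Binary.Bundles using (Setoid)
open import Relation.Binary.Definitions using (DecidableEquality)
import Relation.Binary.Construct.On as On
open import Relation.Binary.PropositionalEquality using (_≡_; refl; cong)
open import Relation.Nullary.Decidable using (map′; no)
open import Relation.Nullary.Negation using (¬_)
open import Relation.Unary using (Pred)

-- The countably infinite supply of variables is ℕ.
Variable : Set
Variable = ℕ

data Literal : Set where
  pos neg : Variable → Literal

complement : Literal → Literal
complement (pos v) = neg v
complement (neg v) = pos v

var : Literal → Variable
var (pos v) = v
var (neg v) = v

_≟_ : DecidableEquality Literal
pos v ≟ pos w = map′ (cong pos) (λ { refl → refl }) (v ℕ.≟ w)
pos v ≟ neg w = no λ ()
neg v ≟ pos w = no λ ()
neg v ≟ neg w = map′ (cong neg) (λ { refl → refl }) (v ℕ.≟ w)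

open import Data.List.Membership.DecPropositional _≟_ using (_∈?_)

-- The list presents the finite set of its members: repetitions and order
-- are irrelevant, and clauses are compared by _≈_ of clauseSetoid below.
record Clause : Set where
  field
    literals  : List Literal
    clashFree : ∀ {x} → x ∈ literals → complement x ∉ literals

open Clause public

clauseSetoid : Setoid 0ℓ 0ℓ
clauseSetoid = On.setoid ([ set ]-Equality Literal) literals

open Setoid clauseSetoid public using () renaming (_≈_ to _≈ᶜ_)

-- The clauses are listed without repetition up to set equality, so that the
-- length of the list is the number of clauses.
record ClauseSet : Set where
  field
    clauses : List Clause
    unique  : Unique clauseSetoid clauses

open ClauseSet public

vars : ClauseSet → List Variable
vars F = deduplicate ℕ._≟_ (concatMap (λ C → map var (literals C)) (clauses F))

n : ClauseSet → ℕ
n F = length (vars F)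

c : ClauseSet → ℕ
c F = length (clauses F)

δ : ClauseSet → ℤ
δ F = + c F ℤ.- + n F

Assignment : Set
Assignment = Variable → Bool

eval : Assignment → Literal → Bool
eval φ (pos v) = φ v
eval φ (neg v) = not (φ v)

Satisfiable : List Clause → Set
Satisfiable Cs = ∃[ φ ] All (λ C → Any (λ x → eval φ x ≡ true) (literals C)) Cs

Unsatisfiable : List Clause → Set
Unsatisfiable Cs = ¬ Satisfiable Cs

-- Since F lists each clause once, deleting the list entry at C∈F
-- yields F ∖ {C}.
MU : Pred ClauseSet 0ℓ
MU F = Unsatisfiable (clauses F)
     × (∀ {C} (C∈F : C ∈ clauses F) → Satisfiable (clauses F ─ C∈F))

Hitting : Pred ClauseSet 0ℓ
Hitting F = ∀ {C D} → C ∈ clauses F → D ∈ clauses F → ¬ (C ≈ᶜ D) →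
            ∃[ x ] (x ∈ literals C × complement x ∈ literals D)

UHIT : Pred ClauseSet 0ℓ
UHIT F = Unsatisfiable (clauses F) × Hitting F

_[δ=_] : Pred ClauseSet 0ℓ → ℕ → Pred ClauseSet 0ℓ
(𝒞 [δ= k ]) F = 𝒞 F × δ F ≡ + k

ld : ClauseSet → Literal → ℕ
ld F x = length (filter (λ C → x ∈? literals C) (clauses F))

vdeg : ClauseSet → Variable → ℕ
vdeg F v = ld F (pos v) + ld F (neg v)

minOver : {A : Set} (f : A → ℕ) (xs : List A) → 0 < length xs → ℕ
minOver f (x ∷ xs) _ = min (f x) (map f xs)

minvdeg : (F : ClauseSet) → 0 < n F → ℕ
minvdeg F n>0 = minOver (vdeg F) (vars F) n>0

minvdegs : Pred ClauseSet 0ℓ → Pred ℕ 0ℓ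
minvdegs 𝒟 m = ∃[ F ] (𝒟 F × ∃[ n>0 ] minvdeg F n>0 ≡ m)

UpperBound : Pred ℕ 0ℓ → Pred ℕ 0ℓ
UpperBound S b = ∀ {m} → S m → m ≤ b

IsSup : Pred ℕ 0ℓ → Pred ℕ 0ℓ
IsSup S s = UpperBound S s × (∀ {b} → UpperBound S b → s ≤ b)

-- The supremum is a relation, since it might be infinite for a general 𝒟.
minvdeg[_]≡_ : Pred ClauseSet 0ℓ → ℕ → Set
minvdeg[ 𝒟 ]≡ s = IsSup (minvdegs 𝒟) s

-- With k = 2 + k′ and i = 2 + j, the index i ranges over {2,…,k} as j ranges
-- over {0,…,k′}, and k - i + 1 = suc (k′ ∸ j).  The value at 0 is a dummy.
N-acc : ∀ k → Acc _<_ k → ℕ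
N-acc zero           _        = 0
N-acc (suc zero)     _        = 2
N-acc (suc (suc k′)) (acc rs) = max 0 (map term (upTo (suc k′)))
  where
  term : ℕ → ℕ
  term j = (2 * i) ⊓ (N-acc (suc (k′ ∸ j)) (rs (s≤s (s≤s (m∸n≤m k′ j)))) + i)
    where
    i : ℕ
    i = 2 + j

N : ℕ → ℕ
N k = N-acc k (<-wellFounded k)

_ : map N (1 ∷ 2 ∷ 3 ∷ 4 ∷ 5 ∷ 6 ∷ []) ≡ 2 ∷ 4 ∷ 5 ∷ 6 ∷ 8 ∷ 9 ∷ []
_ = refl

-- The upper bound is an induction on the number of variables.  Add literals to the clauses of a
-- minimally unsatisfiable F of deficiency k as long as F stays unsatisfiable; degrees only grow.  In
-- the saturated F, setting a literal x over a variable v of minimum degree to true keeps F minimally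
-- unsatisfiable, and no other variable w gets lost, since it would have vdeg(w) ≤ ld(x) < vdeg(v).
-- If x is the more frequent literal of v and i = ld(x), the new deficiency is k - i + 1, which must
-- be positive, so i ≤ k; moreover vdeg(v) ≤ 2i, and by induction some w has degree at most
-- N(k - i + 1) before the i removed clauses are put back.  The bound holds for every k; for k ≤ 5 it
-- is attained by clause-sets obtained from the cubes of all 2^m full clauses over m ≤ 3 variables.
module Submission where

open import Defs
open import Data.Bool.Base using (Bool; true; false; not; _∧_)
import Data.Bool.Properties as Bool
open import Data.Fin.Base as Fin using (Fin; zero; suc)
import Data.Fin.Properties as Fin
open import Data.Integer.Base as ℤ using (+_)
import Data.Integer.Properties as ℤ
open import Data.List.Base using (List; []; _∷_; drop; length; _++_; map; filter; lookup; allFin; upTo; cartesianProduct)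
open import Data.List.Extrema.Nat using (argmin; argmin-sel; f[argmin]≤f[⊤]; f[argmin]≤f[xs]; max; v≤max⁺; min≤⊤; min≤xs)
open import Data.List.Membership.Propositional using (_∈_; _∉_; find; lose)
open import Data.List.Membership.DecPropositional _≟_ using (_∈?_; _∉?_)
open import Data.List.Membership.Propositional.Properties
open import Data.List.Properties hiding (≡-dec)
open import Data.List.Relation.Unary.All as All using (All; []; _∷_)
open import Data.List.Relation.Unary.All.Properties using (─⁺)
open import Data.List.Relation.Unary.Any as Any using (Any; here; there; any?; _─_)
open import Data.List.Relation.Unary.Any.Properties using (lookup-index)
import Data.List.Relation.Unary.AllPairs as AllPairs
open AllPairs using ([]; _∷_)
open import Data.List.Relation.Unary.Unique.Propositional using (Unique)
import Data.List.Relation.Unary.Unique.Propositional.Properties as Unique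
import Data.List.Relation.Unary.Unique.Setoid as Distinct
import Data.List.Relation.Unary.Unique.DecPropositional.Properties as DecUnique
open import Data.Maybe.Base using (Maybe; just; nothing)
open import Data.Maybe.Properties using (≡-dec; just-injective)
open import Data.Nat.Base
open import Data.Nat.Induction using (Acc; acc; <-wellFounded)
open import Data.Nat.Properties as ℕ using (≤-trans; ≤-refl; ≤-reflexive)
open import Data.Product.Base using (∃-syntax; _×_; _,_; proj₁; proj₂)
open import Data.Sum.Base using (_⊎_; inj₁; inj₂; [_,_]′)
open import Data.Vec.Base using (Vec; []; _∷_)
open import Function.Base using (_∘_; id; case_of_)
open import Function.Bundles using (Equivalence)
open import Level using (0ℓ)
open import Relation.Binary.Bundles using (Setoid)
open import Relation.Binary.Definitions using (DecidableEquality)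
open import Relation.Binary.PropositionalEquality
open import Relation.Nullary
open import Relation.Nullary.Decidable using (True; toWitness; ¬¬-excluded-middle; decidable-stable; ¬?; _×-dec_; _→-dec_; dec-true; dec-false)
open import Relation.Unary using (Pred; Decidable)

-- Counting with filters

module _ {A : Set} {P Q : Pred A 0ℓ} (P? : Decidable P) (Q? : Decidable Q) where

  length-filter-mono : (∀ {x} → P x → Q x) → ∀ xs → length (filter P? xs) ≤ length (filter Q? xs)
  length-filter-mono P⊆Q [] = z≤n
  length-filter-mono P⊆Q (x ∷ xs) with P? x | Q? x
  ... | yes p | yes q = s≤s (length-filter-mono P⊆Q xs)
  ... | yes p | no ¬q = contradiction (P⊆Q p) ¬q
  ... | no ¬p | yes q = ℕ.m≤n⇒m≤1+n (length-filter-mono P⊆Q xs)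
  ... | no ¬p | no ¬q = length-filter-mono P⊆Q xs

  -- Each element of `P` either survives the removal of `Q` or is counted in `Q`. Applied to rows,
  -- this bounds the occurrences lost in a split.
  length-filter-avoiding : ∀ xs →
    length (filter P? xs) ≤ length (filter P? (filter (¬? ∘ Q?) xs)) + length (filter Q? xs)
  length-filter-avoiding [] = z≤n
  length-filter-avoiding (x ∷ xs) with Q? x
  length-filter-avoiding (x ∷ xs) | no ¬q with P? x
  ... | yes p = s≤s (length-filter-avoiding xs)
  ... | no ¬p = length-filter-avoiding xs
  length-filter-avoiding (x ∷ xs) | yes q with P? x
  ... | yes p = ≤-trans (s≤s (length-filter-avoiding xs)) (≤-reflexive (sym (ℕ.+-suc _ _)))
  ... | no ¬p = ≤-trans (length-filter-avoiding xs) (ℕ.+-monoʳ-≤ _ (ℕ.n≤1+n _))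

length-filter-¬ : {A : Set} {P : Pred A 0ℓ} (P? : Decidable P) → ∀ xs →
  length (filter (¬? ∘ P?) xs) + length (filter P? xs) ≡ length xs
length-filter-¬ P? [] = refl
length-filter-¬ P? (x ∷ xs) with P? x
... | yes p = trans (ℕ.+-suc _ _) (cong suc (length-filter-¬ P? xs))
... | no ¬p = cong suc (length-filter-¬ P? xs)

length-filter-≢ : ∀ {v xs} → Unique xs → v ∈ xs →
  suc (length (filter (¬? ∘ (v ℕ.≟_)) xs)) ≡ length xs
length-filter-≢ {v} (v∉xs ∷ _) (here refl) =
  cong (suc ∘ length) (trans (filter-reject (¬? ∘ (v ℕ.≟_)) (λ v≢v → v≢v refl))
                             (filter-all (¬? ∘ (v ℕ.≟_)) v∉xs))
length-filter-≢ {v} (x∉xs ∷ u) (there v∈xs) =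
  trans (cong (suc ∘ length) (filter-accept (¬? ∘ (v ℕ.≟_)) (λ v≡x → All.lookup x∉xs v∈xs (sym v≡x))))
        (cong suc (length-filter-≢ u v∈xs))

0<length-filter⇒∃ : {A : Set} {P : Pred A 0ℓ} (P? : Decidable P) → ∀ xs →
  0 < length (filter P? xs) → ∃[ x ] (x ∈ xs × P x)
0<length-filter⇒∃ P? (x ∷ xs) 0<l with P? x
... | yes p = x , here refl , p
... | no _ with y , y∈xs , p ← 0<length-filter⇒∃ P? xs 0<l = y , there y∈xs , p

∃⇒0<length-filter : {A : Set} {P : Pred A 0ℓ} (P? : Decidable P) → ∀ {x xs} →
  x ∈ xs → P x → 0 < length (filter P? xs)
∃⇒0<length-filter P? (here refl) p = filter-some P? (here p)
∃⇒0<length-filter {P = P} P? x∈xs p = filter-some P? (Any.map (λ x≡y → subst P x≡y p) x∈xs)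

-- The function N

-- The recursive calls inside `N` carry accessibility proofs of their own; this identifies their
-- values with `N` at the smaller argument.
N-acc-irrelevant : ∀ k (a b : Acc _<_ k) → N-acc k a ≡ N-acc k b
N-acc-irrelevant zero          _        _        = refl
N-acc-irrelevant (suc zero)    _        _        = refl
N-acc-irrelevant (suc (suc k)) (acc rs) (acc ss) = cong (max 0) (map-cong
  (λ j → cong (λ m → (2 * (2 + j)) ⊓ (m + (2 + j))) (N-acc-irrelevant _ (rs (j< j)) (ss (j< j))))
  (upTo (suc k)))
  where
  j< : ∀ j → suc (k ∸ j) < 2 + k
  j< j = s≤s (s≤s (ℕ.m∸n≤m k j))

N-acc-step : ∀ {k j} → j ≤ k → (a : Acc _<_ (suc (k ∸ j))) (b : Acc _<_ (2 + k)) →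
  (2 * (2 + j)) ⊓ (N-acc (suc (k ∸ j)) a + (2 + j)) ≤ N-acc (2 + k) b
N-acc-step {k} {j} j≤k a (acc rs) = v≤max⁺ 0 _ (inj₂ (Any.map
  (λ {m} eq → subst (_ ≤_) eq (≤-reflexive
    (cong (λ m → (2 * (2 + j)) ⊓ (m + (2 + j))) (N-acc-irrelevant (suc (k ∸ j)) a (rs (s≤s (s≤s (ℕ.m∸n≤m k j))))))))
  (∈-map⁺ _ (∈-upTo⁺ (s≤s j≤k)))))

N-step : ∀ {k i} → 2 ≤ i → i ≤ k → (2 * i) ⊓ (N (suc (k ∸ i)) + i) ≤ N k
N-step {suc (suc k)} {suc (suc j)} (s≤s (s≤s _)) (s≤s (s≤s j≤k)) =
  N-acc-step j≤k (<-wellFounded (suc (k ∸ j))) (<-wellFounded (2 + k))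

-- For k ≥ 2 the index i = k suffices: its term is the minimum of 2k and N(1) + k = k + 2.
1+k≤N : ∀ {k} → 1 ≤ k → suc k ≤ N k
1+k≤N {suc zero}    _ = ≤-refl
1+k≤N {suc (suc k)} _ = ≤-trans (ℕ.⊓-glb left right) (N-step {2 + k} {2 + k} (s≤s (s≤s z≤n)) ≤-refl)
  where
  left : 3 + k ≤ 2 * (2 + k)
  left = s≤s (s≤s (≤-trans (≤-reflexive (ℕ.+-comm 1 k)) (ℕ.+-monoʳ-≤ k (s≤s z≤n))))
  right : 3 + k ≤ N (suc (k ∸ k)) + (2 + k)
  right rewrite ℕ.n∸n≡0 k = ℕ.n≤1+n (3 + k)

-- Minimally unsatisfiable signed matrices

-- R i v is the sign with which the variable v occurs in row i, if any.
Matrix : Set → Set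
Matrix I = I → Variable → Maybe Bool

_⊨_ : Assignment → (Variable → Maybe Bool) → Set
φ ⊨ r = ∃[ v ] r v ≡ just (φ v)

_≟ₑ_ : DecidableEquality (Maybe Bool)
_≟ₑ_ = ≡-dec Bool._≟_

occurs? : ∀ {I} (R : Matrix I) v → Decidable (λ i → R i v ≢ nothing)
occurs? R v i = ¬? (R i v ≟ₑ nothing)

just≢nothing : ∀ {x : Maybe Bool} {b} → x ≡ just b → x ≢ nothing
just≢nothing refl ()

occurs⇒just : ∀ {x : Maybe Bool} → x ≢ nothing → ∃[ b ] x ≡ just b
occurs⇒just {just b}  _   = b , refl
occurs⇒just {nothing} x≢n = contradiction refl x≢n

_[_≔_] : Assignment → Variable → Bool → Assignment
(φ [ v ≔ b ]) w with w ℕ.≟ v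
... | yes _ = b
... | no _  = φ w

≔-at : ∀ φ v b → (φ [ v ≔ b ]) v ≡ b
≔-at φ v b with v ℕ.≟ v
... | yes _  = refl
... | no v≢v = contradiction refl v≢v

≔-off : ∀ φ v b {w} → w ≢ v → (φ [ v ≔ b ]) w ≡ φ w
≔-off φ v b {w} w≢v with w ℕ.≟ v
... | yes w≡v = contradiction w≡v w≢v
... | no _    = refl

module _ {I : Set} (_≟ᵢ_ : DecidableEquality I) where

  -- Rows keep their names in `I` while the list `Is` shrinks, so a split needs no renumbering.
  Unsat : List I → Matrix I → Set
  Unsat Is R = ¬ (∃[ φ ] (∀ {i} → i ∈ Is → φ ⊨ R i))

  SatWithout : List I → Matrix I → I → Assignment → Set
  SatWithout Is R i φ = ∀ {j} → j ∈ Is → j ≢ i → φ ⊨ R j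

  record MinUnsat (Is : List I) (R : Matrix I) : Set where
    constructor _,_
    field
      unsat    : Unsat Is R
      critical : ∀ {i} → i ∈ Is → ∃[ φ ] SatWithout Is R i φ

  open MinUnsat

  ldeg : List I → Matrix I → Variable → Bool → ℕ
  ldeg Is R v b = length (filter (λ i → R i v ≟ₑ just b) Is)

  deg : List I → Matrix I → Variable → ℕ
  deg Is R v = length (filter (occurs? R v) Is)

  deg≡ : ∀ Is R v b → deg Is R v ≡ ldeg Is R v b + ldeg Is R v (not b)
  deg≡ [] R v b = refl
  deg≡ (i ∷ Is) R v b with R i v
  ... | nothing = deg≡ Is R v b
  deg≡ (i ∷ Is) R v false | just false = cong suc (deg≡ Is R v false)
  deg≡ (i ∷ Is) R v false | just true  = trans (cong suc (deg≡ Is R v false)) (sym (ℕ.+-suc _ _))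
  deg≡ (i ∷ Is) R v true  | just true  = cong suc (deg≡ Is R v true)
  deg≡ (i ∷ Is) R v true  | just false = trans (cong suc (deg≡ Is R v true)) (sym (ℕ.+-suc _ _))

  -- Otherwise the assignment would satisfy row `i` as well, hence the whole matrix.
  falsified : ∀ {Is R i φ} → Unsat Is R → SatWithout Is R i φ → ∀ {w} → R i w ≢ just (φ w)
  falsified {i = i} {φ} us sat eq = us (φ , λ {j} j∈ → case j ≟ᵢ i of λ where
    (yes refl) → _ , eq
    (no j≢i)   → sat j∈ j≢i)

  flip-opposite : ∀ {R : Matrix I} {v b φ j} → φ ⊨ R j → R j v ≢ just (not b) → (φ [ v ≔ b ]) ⊨ R j
  flip-opposite {R} {v} {b} {φ} {j} (w , eq) ≢nb = case w ℕ.≟ v of λ where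
    (no w≢v)   → w , trans eq (cong just (sym (≔-off φ v b w≢v)))
    (yes refl) → v , trans eq (cong just (case φ v Bool.≟ b of λ where
      (yes φv≡b) → trans φv≡b (sym (≔-at φ v b))
      (no φv≢b)  → contradiction (trans eq (cong just (Bool.¬-not φv≢b))) ≢nb))

  -- A pure literal is impossible: take a critical assignment for a row containing it and make the
  -- literal true. No row contains the complement, so all rows become satisfied.
  both-signs : ∀ {Is R v} → MinUnsat Is R → 0 < deg Is R v → ∀ b → 0 < ldeg Is R v b
  both-signs {Is} {R} {v} mu 0<d b with 0<length-filter⇒∃ (occurs? R v) Is 0<d
  ... | i , i∈ , occ with occurs⇒just occ
  ... | b′ , eq with b′ Bool.≟ b
  ... | yes refl = ∃⇒0<length-filter (λ i → R i v ≟ₑ just b) i∈ eq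
  ... | no b′≢b = ℕ.n≢0⇒n>0 λ none →
    let φ , sat = critical mu i∈
        absent : ∀ {j} → j ∈ Is → R j v ≢ just b
        absent j∈ e = ℕ.<⇒≢ (∃⇒0<length-filter (λ i → R i v ≟ₑ just b) j∈ e) (sym none)
    in unsat mu (φ [ v ≔ not b ] , λ {j} j∈ → case j ≟ᵢ i of λ where
         (yes refl) → v , trans eq (cong just (trans (Bool.¬-not b′≢b) (sym (≔-at φ v (not b)))))
         (no j≢i) → flip-opposite {R} (sat j∈ j≢i)
            (λ e → absent j∈ (trans e (cong just (Bool.not-involutive b)))))

  -- Saturation

  _⊑_ : Matrix I → Matrix I → Set
  R ⊑ R′ = ∀ {i v b} → R i v ≡ just b → R′ i v ≡ just b

  ⊨-mono : ∀ {R R′ i φ} → R ⊑ R′ → φ ⊨ R i → φ ⊨ R′ i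
  ⊨-mono R⊑R′ (v , eq) = v , R⊑R′ eq

  deg-mono : ∀ {Is R R′ v} → R ⊑ R′ → deg Is R v ≤ deg Is R′ v
  deg-mono {Is} {R} {R′} {v} R⊑R′ = length-filter-mono (occurs? R v) (occurs? R′ v)
    (λ occ → just≢nothing (R⊑R′ (proj₂ (occurs⇒just occ)))) Is

  CriticalAt : List I → Matrix I → I × Variable × Bool → Set
  CriticalAt Is R (i , v , b) = ∃[ φ ] (φ v ≡ b × SatWithout Is R i φ)

  -- The critical assignment would satisfy the matrix once `b` were entered at the empty place.
  -- Saturation is stated through this witness because splitting uses it.
  SaturatedAt : List I → Matrix I → I × Variable × Bool → Set
  SaturatedAt Is R t@(i , v , b) = R i v ≡ nothing → CriticalAt Is R t

  _⊕_ : Matrix I → I × Variable × Bool → Matrix I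
  (R ⊕ (i , v , b)) j w with R j w | j ≟ᵢ i | w ℕ.≟ v
  ... | just c  | _     | _     = just c
  ... | nothing | yes _ | yes _ = just b
  ... | nothing | yes _ | no _  = nothing
  ... | nothing | no _  | _     = nothing

  ⊕-⊒ : ∀ R t → R ⊑ (R ⊕ t)
  ⊕-⊒ R t eq rewrite eq = refl

  ⊕-at : ∀ R i v b → (R ⊕ (i , v , b)) i v ≢ nothing
  ⊕-at R i v b with R i v | i ≟ᵢ i | v ℕ.≟ v
  ... | just _  | _       | _       = λ ()
  ... | nothing | yes _   | yes _   = λ ()
  ... | nothing | no i≢i  | yes _   = contradiction refl i≢i
  ... | nothing | _       | no v≢v  = contradiction refl v≢v

  ⊕-inv : ∀ R i v b {j w c} → (R ⊕ (i , v , b)) j w ≡ just c →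
    R j w ≡ just c ⊎ (j ≡ i × w ≡ v × b ≡ c)
  ⊕-inv R i v b {j} {w} eq with R j w | j ≟ᵢ i | w ℕ.≟ v
  ... | just _  | _     | _     = inj₁ eq
  ... | nothing | yes p | yes q = inj₂ (p , q , just-injective eq)
  ... | nothing | yes _ | no _  = contradiction eq λ ()
  ... | nothing | no _  | _     = contradiction eq λ ()

  -- A satisfying assignment of the larger matrix either uses old entries only, or it needs the new
  -- one in row `i` and is then critical with value `b` at `v`.
  ⊕-unsat : ∀ {Is R i v b} → Unsat Is R → ¬ CriticalAt Is R (i , v , b) → Unsat Is (R ⊕ (i , v , b))
  ⊕-unsat {Is} {R} {i} {v} {b} us ¬crit (φ , sat) = us (φ , λ {j} j∈ → case sat j∈ of λ where
      (w , eq) → case ⊕-inv R i v b eq of λ where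
        (inj₁ old)               → w , old
        (inj₂ (refl , refl , b≡φv)) → contradiction (φ , sym b≡φv , others) ¬crit)
    where
    others : SatWithout Is R i φ
    others k∈ k≢i with sat k∈
    ... | w , eq with ⊕-inv R i v b eq
    ... | inj₁ old       = w , old
    ... | inj₂ (k≡i , _) = contradiction k≡i k≢i

  -- Satisfiability is not decided here: the double negation disappears in degreeBound, whose
  -- conclusion is decidable.
  saturate : ∀ {Is} ts {R} → Unsat Is R →
    ¬ ¬ (∃[ R′ ] (R ⊑ R′ × Unsat Is R′ × All (SaturatedAt Is R′) ts))
  saturate [] {R} us k = k (R , id , us , [])
  saturate {Is} (t@(i , v , b) ∷ ts) {R} us k = ¬¬-excluded-middle {A = CriticalAt Is R t} λ where
    -- Later additions keep satisfied rows satisfied, so this witness persists and one pass over the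
    -- places suffices.
    (yes (φ , φv≡b , sat)) → saturate ts us λ where
      (R′ , R⊑R′ , us′ , sats) → k (R′ , R⊑R′ , us′ ,
        (λ _ → φ , φv≡b , λ j∈ j≢i → ⊨-mono {R} {R′} R⊑R′ (sat j∈ j≢i)) ∷ sats)
    (no ¬crit) → saturate ts (⊕-unsat us ¬crit) λ where
      (R′ , R+⊑R′ , us′ , sats) → k (R′ , (λ eq → R+⊑R′ (⊕-⊒ R t eq)) , us′ ,
        (λ R′iv≡n → contradiction R′iv≡n
          (just≢nothing (R+⊑R′ (proj₂ (occurs⇒just (⊕-at R i v b)))))) ∷ sats)

  -- Splitting

  -- Together with `_∖_` this is the assignment of `b` to `v`: satisfied rows disappear, and the
  -- column of `v` is erased from the others.
  rowsWithout : List I → Matrix I → Variable → Bool → List I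
  rowsWithout Is R v b = filter (λ i → ¬? (R i v ≟ₑ just b)) Is

  _∖_ : Matrix I → Variable → Matrix I
  (R ∖ v) i w with w ℕ.≟ v
  ... | yes _ = nothing
  ... | no _  = R i w

  ∖-off : ∀ R {v w i} → w ≢ v → (R ∖ v) i w ≡ R i w
  ∖-off R {v} {w} w≢v with w ℕ.≟ v
  ... | yes w≡v = contradiction w≡v w≢v
  ... | no _    = refl

  ∖-inv : ∀ R {v w i b} → (R ∖ v) i w ≡ just b → w ≢ v × R i w ≡ just b
  ∖-inv R {v} {w} eq with w ℕ.≟ v
  ... | yes _  = contradiction eq λ ()
  ... | no w≢v = w≢v , eq

  -- Criticality needs, for each remaining row, a critical assignment with value `b` at `v`. If `v`
  -- is absent from the row, saturation supplies it. If `v` occurs with the opposite sign, every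
  -- critical assignment falsifies that entry and so has value `b` at `v`.
  split-minUnsat : ∀ {Is R v b} → MinUnsat Is R → (∀ {i} → i ∈ Is → SaturatedAt Is R (i , v , b)) →
    MinUnsat (rowsWithout Is R v b) (R ∖ v)
  split-minUnsat {Is} {R} {v} {b} mu saturated = us , crit
    where
    Is′ = rowsWithout Is R v b
    ∈Is′ : ∀ {i} → i ∈ Is → R i v ≢ just b → i ∈ Is′
    ∈Is′ = ∈-filter⁺ (λ i → ¬? (R i v ≟ₑ just b))
    Is′∈ : ∀ {i} → i ∈ Is′ → i ∈ Is × R i v ≢ just b
    Is′∈ = ∈-filter⁻ (λ i → ¬? (R i v ≟ₑ just b)) {xs = Is}

    us : Unsat Is′ (R ∖ v)
    us (φ , sat) = unsat mu (φ [ v ≔ b ] , λ {i} i∈ → case R i v ≟ₑ just b of λ where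
      (yes eq) → v , trans eq (cong just (sym (≔-at φ v b)))
      (no neq) → case sat (∈Is′ i∈ neq) of λ where
        (w , eq) → let w≢v , eq′ = ∖-inv R eq in
          w , trans eq′ (cong just (sym (≔-off φ v b w≢v))))

    criticalAt : ∀ {i} → i ∈ Is′ → CriticalAt Is R (i , v , b)
    criticalAt {i} i∈ with Is′∈ i∈ | R i v in eq
    ... | i∈Is , neq | nothing = saturated i∈Is eq
    ... | i∈Is , neq | just b′ with critical mu i∈Is
    ... | φ , sat with φ v Bool.≟ b
    ... | yes φv≡b = φ , φv≡b , sat
    ... | no φv≢b = contradiction
      (trans eq (cong just (trans (Bool.¬-not (λ b′≡b → neq (trans eq (cong just b′≡b)))) (sym (Bool.¬-not φv≢b)))))
      (falsified {R = R} (unsat mu) sat)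

    crit : ∀ {i} → i ∈ Is′ → ∃[ φ ] SatWithout Is′ (R ∖ v) i φ
    crit i∈ with criticalAt i∈
    ... | φ , φv≡b , sat = φ , λ {j} j∈ j≢i → let j∈Is , neq = Is′∈ j∈ in
      case sat j∈Is j≢i of λ where
        (w , eq) → w , trans (∖-off R {i = j} λ where refl → neq (trans eq (cong just φv≡b))) eq

  deg-split : ∀ {Is R v w} b → w ≢ v →
    deg Is R w ≤ deg (rowsWithout Is R v b) (R ∖ v) w + ldeg Is R v b
  deg-split {Is} {R} {v} {w} b w≢v = ≤-trans
    (length-filter-avoiding (occurs? R w) (λ i → R i v ≟ₑ just b) Is)
    (ℕ.+-monoˡ-≤ _ (length-filter-mono (occurs? R w) (occurs? (R ∖ v) w)
      (λ {i} occ e → occ (trans (sym (∖-off R {i = i} w≢v)) e)) (rowsWithout Is R v b)))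

  -- The degree bound

  -- Both parts go through one induction: positive deficiency after a split is what confines the
  -- index `i` to the range of the recursion for `N`.
  DegreeBound : List I → Matrix I → List Variable → Set
  DegreeBound Is R Vs = length Vs < length Is ×
    (0 < length Vs → Any (λ v → deg Is R v ≤ N (length Is ∸ length Vs)) Vs)

  degreeBound? : ∀ Is R Vs → Dec (DegreeBound Is R Vs)
  degreeBound? Is R Vs = length Vs ℕ.<? length Is ×-dec
    (0 ℕ.<? length Vs →-dec any? (λ v → deg Is R v ℕ.≤? _) Vs)

  degreeBound-anti : ∀ {Is R R′ Vs} → R ⊑ R′ → DegreeBound Is R′ Vs → DegreeBound Is R Vs
  degreeBound-anti {Is} {R} {R′} R⊑R′ (lt , bound) =
    lt , λ 0<Vs → Any.map (≤-trans (deg-mono {Is} {R} {R′} R⊑R′)) (bound 0<Vs)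

  matrix-mono : ∀ {Is R R′} → R ⊑ R′ → Unsat Is R′ → MinUnsat Is R → MinUnsat Is R′
  matrix-mono {R = R} {R′} R⊑R′ us mu = us , λ i∈ → case critical mu i∈ of λ where
    (φ , sat) → φ , λ j∈ j≢i → ⊨-mono {R} {R′} R⊑R′ (sat j∈ j≢i)

  unsat⇒nonempty : ∀ {Is R} → Unsat Is R → 0 < length Is
  unsat⇒nonempty {[]}    us = contradiction ((λ _ → true) , λ ()) us
  unsat⇒nonempty {_ ∷ _} us = s≤s z≤n

  minimum : ∀ (f : Variable → ℕ) Vs → 0 < length Vs → ∃[ v ] (v ∈ Vs × (∀ {w} → w ∈ Vs → f v ≤ f w))
  minimum f (x ∷ xs) _ = argmin f x xs , member , least
    where
    least : ∀ {w} → w ∈ x ∷ xs → f (argmin f x xs) ≤ f w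
    least (here refl)  = f[argmin]≤f[⊤] {f = f} x xs
    least (there w∈xs) = All.lookup (f[argmin]≤f[xs] {f = f} x xs) w∈xs
    member : argmin f x xs ∈ x ∷ xs
    member = [ here , there ]′ (argmin-sel f x xs)

  -- d is the minimum degree, i the number of rows removed; there are c rows and suc a′ columns before
  -- splitting, c′ rows and a′ columns after it.
  split-arith : ∀ {a′ c c′ i d} → c′ + i ≡ c → a′ < c′ → 1 ≤ i → d ≤ 2 * i → d ≤ c →
    (0 < a′ → d ≤ N (c′ ∸ a′) + i) → suc a′ < c × d ≤ N (c ∸ suc a′)
  split-arith {a′} {c} {c′} {i} {d} c′+i≡c a′<c′ 1≤i d≤2i d≤c ih = a<c , d≤N
    where
    a<c : suc a′ < c
    a<c = subst (suc (suc a′) ≤_) c′+i≡c (subst (_≤ c′ + i) (ℕ.+-comm (suc a′) 1) (ℕ.+-mono-≤ a′<c′ 1≤i))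
    k = c ∸ suc a′
    -- By `a′ < c′` the subtraction is exact; this gives `i ≤ k` and the new deficiency
    -- `suc (k ∸ i)`.
    k≡ : k ≡ (c′ ∸ suc a′) + i
    k≡ = trans (cong (_∸ suc a′) (sym c′+i≡c)) (ℕ.+-∸-comm i a′<c′)
    i≤k : i ≤ k
    i≤k = subst (i ≤_) (sym k≡) (ℕ.m≤n+m i _)
    1≤k : 1 ≤ k
    1≤k = ≤-trans 1≤i i≤k
    c′∸a′ : c′ ∸ a′ ≡ suc (k ∸ i)
    c′∸a′ = trans (ℕ.+-∸-assoc 1 {c′} {suc a′} a′<c′)
      (cong suc (sym (trans (cong (_∸ i) k≡) (ℕ.m+n∸n≡m (c′ ∸ suc a′) i))))
    large : d ≤ suc k → d ≤ N k
    large d≤1+k = ≤-trans d≤1+k (1+k≤N 1≤k)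
    d≤N : d ≤ N k
    -- The recursion for `N` starts at index 2, and the induction hypothesis needs a remaining
    -- column. The two exceptions give `d ≤ suc k`: d ≤ 2 if i = 1, and d ≤ c = k + 1 if no column
    -- remains.
    d≤N with i ℕ.≟ 1 | a′ ℕ.≟ 0
    ... | yes refl | _        = large (≤-trans d≤2i (s≤s 1≤k))
    ... | no _     | yes refl = large (≤-trans d≤c (ℕ.m≤n+m∸n c 1))
    ... | no i≢1   | no a′≢0  = ≤-trans
      (ℕ.⊓-glb d≤2i (subst (λ m → d ≤ N m + i) c′∸a′ (ih (ℕ.n≢0⇒n>0 a′≢0))))
      (N-step {k} {i} (ℕ.≤∧≢⇒< 1≤i (i≢1 ∘ sym)) i≤k)

  -- Minimality of `v` is used twice: it keeps every other listed variable alive, and it turns a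
  -- bound on some `w` after the split into one on `v`.
  split-degreeBound : ∀ {Is R Vs} → Unique Vs → MinUnsat Is R → (∀ {v} → v ∈ Vs → 0 < deg Is R v) →
    0 < length Vs → (∀ {i v b} → i ∈ Is → v ∈ Vs → SaturatedAt Is R (i , v , b)) →
    (∀ {Is′ R′ Vs′} → suc (length Vs′) ≡ length Vs → Unique Vs′ → MinUnsat Is′ R′ →
      (∀ {v} → v ∈ Vs′ → 0 < deg Is′ R′ v) → DegreeBound Is′ R′ Vs′) →
    DegreeBound Is R Vs
  split-degreeBound {Is} {R} {Vs} uniq mu occurring 0<Vs saturated ih
    with minimum (deg Is R) Vs 0<Vs
  ... | v , v∈Vs , least = case ℕ.≤-total (ldeg Is R v false) (ldeg Is R v true) of λ where
      (inj₁ f≤t) → split true f≤t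
      (inj₂ t≤f) → split false t≤f
    where
    Vs′ = filter (¬? ∘ (v ℕ.≟_)) Vs

    |Vs′| : suc (length Vs′) ≡ length Vs
    |Vs′| = length-filter-≢ uniq v∈Vs

    -- Making the majority literal true gives `d ≤ 2 * i` for the number `i` of removed rows.
    split : ∀ b → ldeg Is R v (not b) ≤ ldeg Is R v b → DegreeBound Is R Vs
    split b majority = subst (_< length Is) |Vs′| (proj₁ result) ,
      λ _ → Any.map (λ { refl → subst (λ a → d ≤ N (length Is ∸ a)) |Vs′| (proj₂ result) }) v∈Vs
      where
      Is′ = rowsWithout Is R v b
      d = deg Is R v
      signs = both-signs mu (occurring v∈Vs)

      Vs′⊆ : ∀ {w} → w ∈ Vs′ → w ∈ Vs × w ≢ v
      Vs′⊆ w∈ with ∈-filter⁻ (¬? ∘ (v ℕ.≟_)) {xs = Vs} w∈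
      ... | w∈Vs , v≢w = w∈Vs , v≢w ∘ sym

      d≤ : ∀ {w} → w ∈ Vs′ → d ≤ deg Is′ (R ∖ v) w + ldeg Is R v b
      d≤ w∈ = ≤-trans (least (proj₁ (Vs′⊆ w∈))) (deg-split {Is} {R} b (proj₂ (Vs′⊆ w∈)))

      -- A variable occurring only in the removed rows would have smaller degree than v.
      occurring′ : ∀ {w} → w ∈ Vs′ → 0 < deg Is′ (R ∖ v) w
      occurring′ {w} w∈ = ≤-trans (signs (not b)) (ℕ.+-cancelʳ-≤ (ldeg Is R v b) _ _
        (subst (_≤ deg Is′ (R ∖ v) w + ldeg Is R v b)
          (trans (deg≡ Is R v b) (ℕ.+-comm (ldeg Is R v b) _)) (d≤ w∈)))

      smaller : DegreeBound Is′ (R ∖ v) Vs′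
      smaller = ih |Vs′| (Unique.filter⁺ (¬? ∘ (v ℕ.≟_)) uniq)
        (split-minUnsat mu (λ i∈ → saturated i∈ v∈Vs)) occurring′

      result : suc (length Vs′) < length Is × d ≤ N (length Is ∸ suc (length Vs′))
      result = split-arith {length Vs′}
        (length-filter-¬ (λ i → R i v ≟ₑ just b) Is)
        (proj₁ smaller)
        (signs b)
        (subst₂ _≤_ (sym (deg≡ Is R v b)) (cong (λ m → ldeg Is R v b + m) (sym (ℕ.+-identityʳ _)))
          (ℕ.+-monoʳ-≤ _ majority))
        (length-filter (occurs? R v) Is)
        (bound ∘ proj₂ smaller)
        where
        bound : ∀ {m} → Any (λ w → deg Is′ (R ∖ v) w ≤ m) Vs′ → d ≤ m + ldeg Is R v b
        bound found with find found
        ... | w , w∈ , le = ≤-trans (d≤ w∈) (ℕ.+-monoˡ-≤ _ le)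

  degreeBound : ∀ m {Is R Vs} → length Vs ≡ m → Unique Vs → MinUnsat Is R →
    (∀ {v} → v ∈ Vs → 0 < deg Is R v) → DegreeBound Is R Vs
  degreeBound zero {Is} {R} {[]} _ _ mu _ = unsat⇒nonempty {Is} {R} (unsat mu) , λ ()
  degreeBound (suc m) {Is} {R} {Vs} eq uniq mu occurring = decidable-stable (degreeBound? Is R Vs) λ ¬g →
    saturate triples (unsat mu) λ where
      (R′ , R⊑R′ , us , sats) → ¬g (degreeBound-anti {Is} {R} {R′} {Vs} R⊑R′
        (split-degreeBound uniq (matrix-mono R⊑R′ us mu)
          (λ v∈ → ≤-trans (occurring v∈) (deg-mono {Is} {R} {R′} R⊑R′))
          (subst (0 <_) (sym eq) (s≤s z≤n))
          (λ {_} {_} {b} i∈ v∈ → All.lookup sats (∈-cartesianProduct⁺ i∈ (∈-cartesianProduct⁺ v∈ (∈bools b))))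
          (λ eq′ → degreeBound m (ℕ.suc-injective (trans eq′ eq)))))
    where
    bools = true ∷ false ∷ []
    ∈bools : ∀ b → b ∈ bools
    ∈bools true  = here refl
    ∈bools false = there (here refl)
    -- Only variables of `Vs` are ever split on, so these are the places to saturate.
    triples = cartesianProduct Is (cartesianProduct Vs bools)

-- Clause-sets as matrices

literal : Bool → Variable → Literal
literal true  = pos
literal false = neg

literal-surjective : ∀ x → ∃[ b ] x ≡ literal b (var x)
literal-surjective (pos v) = true , refl
literal-surjective (neg v) = false , refl

eval-literal : ∀ φ b v → φ v ≡ b → eval φ (literal b v) ≡ true
eval-literal φ true  v eq = eq
eval-literal φ false v eq = cong not eq

eval-literal⁻ : ∀ φ b v → eval φ (literal b v) ≡ true → φ v ≡ b
eval-literal⁻ φ true  v eq = eq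
eval-literal⁻ φ false v eq = Bool.not-injective eq

eval-complement : ∀ φ x → eval φ (complement x) ≡ not (eval φ x)
eval-complement φ (pos v) = refl
eval-complement φ (neg v) = sym (Bool.not-involutive (φ v))

sign : Clause → Variable → Maybe Bool
sign C v with literal true v ∈? literals C | literal false v ∈? literals C
... | yes _ | _     = just true
... | no _  | yes _ = just false
... | no _  | no _  = nothing

sign⇒∈ : ∀ C {v} b → sign C v ≡ just b → literal b v ∈ literals C
sign⇒∈ C {v} b eq with literal true v ∈? literals C | literal false v ∈? literals C
sign⇒∈ C true  _  | yes v∈ | _      = v∈
sign⇒∈ C false () | yes _  | _
sign⇒∈ C false _  | no _   | yes v∈ = v∈
sign⇒∈ C true  () | no _   | yes _
sign⇒∈ C _     () | no _   | no _

-- `sign` tests the positive literal first; clash-freeness ensures that this hides no negative one.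
∈⇒sign : ∀ C {v} b → literal b v ∈ literals C → sign C v ≡ just b
∈⇒sign C {v} b v∈ with literal true v ∈? literals C | literal false v ∈? literals C
∈⇒sign C true  v∈ | yes _   | _     = refl
∈⇒sign C false v∈ | yes v∈′ | _     = contradiction v∈ (clashFree C v∈′)
∈⇒sign C false v∈ | no _    | yes _ = refl
∈⇒sign C true  v∈ | no v∉   | _     = contradiction v∈ v∉
∈⇒sign C false v∈ | no _    | no v∉ = contradiction v∈ v∉

_satisfies_ : Assignment → Clause → Set
φ satisfies C = Any (λ x → eval φ x ≡ true) (literals C)

⊨⇒satisfies : ∀ {φ} C → φ ⊨ sign C → φ satisfies C
⊨⇒satisfies {φ} C (v , eq) = lose (sign⇒∈ C (φ v) eq) (eval-literal φ (φ v) v refl)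

satisfies⇒⊨ : ∀ {φ} C → φ satisfies C → φ ⊨ sign C
satisfies⇒⊨ {φ} C sat with find sat
... | x , x∈ , true-x with literal-surjective x
... | b , x≡ = var x , trans (∈⇒sign C b (subst (_∈ literals C) x≡ x∈))
  (cong just (sym (eval-literal⁻ φ b (var x) (subst (λ y → eval φ y ≡ true) x≡ true-x))))

matrix : (Cs : List Clause) → Matrix (Fin (length Cs))
matrix Cs i = sign (lookup Cs i)

-- Links the two forms of criticality: deleting a list entry, and omitting the index of a row.
lookup-∈-─ : ∀ {A : Set} (xs : List A) {i j} → j ≢ i → lookup xs j ∈ (xs ─ ∈-lookup {xs = xs} i)
lookup-∈-─ (x ∷ xs) {zero}  {zero}  j≢i = contradiction refl j≢i
lookup-∈-─ (x ∷ xs) {zero}  {suc j} j≢i = ∈-lookup j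
lookup-∈-─ (x ∷ xs) {suc i} {zero}  j≢i = here refl
lookup-∈-─ (x ∷ xs) {suc i} {suc j} j≢i = there (lookup-∈-─ xs (j≢i ∘ cong suc))

MU⇒minUnsat : ∀ {F} → MU F → MinUnsat Fin._≟_ (allFin (c F)) (matrix (clauses F))
MU⇒minUnsat {F} (us , critical) = us′ , λ {i} _ → critical′ i
  where
  us′ : Unsat Fin._≟_ (allFin (c F)) (matrix (clauses F))
  us′ (φ , sat) = us (φ , All.tabulate λ {C} C∈F → ⊨⇒satisfies C
    (subst (λ D → φ ⊨ sign D) (sym (lookup-index C∈F)) (sat (∈-allFin (Any.index C∈F)))))

  critical′ : ∀ i → ∃[ φ ] SatWithout Fin._≟_ (allFin (c F)) (matrix (clauses F)) i φ
  critical′ i with critical (∈-lookup i)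
  ... | φ , sat = φ , λ {j} _ j≢i →
    satisfies⇒⊨ (lookup (clauses F) j) (All.lookup sat (lookup-∈-─ (clauses F) j≢i))

length-filter-lookup : ∀ {A : Set} {P : Pred A 0ℓ} (P? : Decidable P) xs →
  length (filter P? xs) ≡ length (filter (P? ∘ lookup xs) (allFin (length xs)))
length-filter-lookup P? xs = begin
  length (filter P? xs)                                  ≡⟨ cong (length ∘ filter P?) xs≡ ⟩
  length (filter P? (map (lookup xs) is))                ≡⟨ length-filter-map is ⟩
  length (filter (P? ∘ lookup xs) is)                    ∎
  where
  open ≡-Reasoning
  is = allFin (length xs)
  xs≡ : xs ≡ map (lookup xs) is
  xs≡ = sym (trans (map-tabulate id (lookup xs)) (tabulate-lookup xs))
  length-filter-map : ∀ is → length (filter P? (map (lookup xs) is)) ≡ length (filter (P? ∘ lookup xs) is)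
  length-filter-map []       = refl
  length-filter-map (i ∷ is) with does (P? (lookup xs i))
  ... | true  = cong suc (length-filter-map is)
  ... | false = length-filter-map is

module _ (F : ClauseSet) where

  private
    Is = allFin (c F)
    R  = matrix (clauses F)

  ld≤ldeg : ∀ b v → ld F (literal b v) ≤ ldeg Fin._≟_ Is R v b
  ld≤ldeg b v = ≤-trans
    (≤-reflexive (length-filter-lookup (λ C → literal b v ∈? literals C) (clauses F)))
    (length-filter-mono (λ i → literal b v ∈? literals (lookup (clauses F) i)) (λ i → R i v ≟ₑ just b)
      (λ {i} → ∈⇒sign (lookup (clauses F) i) b) Is)

  vdeg≤deg : ∀ v → vdeg F v ≤ deg Fin._≟_ Is R v
  vdeg≤deg v = subst (vdeg F v ≤_) (sym (deg≡ Fin._≟_ Is R v true))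
    (ℕ.+-mono-≤ (ld≤ldeg true v) (ld≤ldeg false v))

  vars-occur : ∀ {v} → v ∈ vars F → 0 < deg Fin._≟_ Is R v
  vars-occur {v} v∈ with find (∈-concatMap⁻ (λ C → map var (literals C)) {xs = clauses F} (∈-deduplicate⁻ ℕ._≟_ _ v∈))
  ... | C , C∈F , v∈C with ∈-map⁻ var v∈C
  ... | x , x∈C , refl with literal-surjective x
  ... | b , x≡ = ∃⇒0<length-filter (occurs? R v) (∈-allFin (Any.index C∈F))
    (subst (λ D → sign D v ≢ nothing) (lookup-index C∈F)
      (just≢nothing (∈⇒sign C b (subst (_∈ literals C) x≡ x∈C))))

minvdeg≤ : ∀ F (n>0 : 0 < n F) {v m} → v ∈ vars F → vdeg F v ≤ m → minvdeg F n>0 ≤ m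
minvdeg≤ F n>0 v∈ le = ≤-trans (minOver≤ (vdeg F) (vars F) n>0 v∈) le
  where
  minOver≤ : ∀ {A : Set} (f : A → ℕ) xs (0<l : 0 < length xs) {x} → x ∈ xs → minOver f xs 0<l ≤ f x
  minOver≤ f (x ∷ xs) _ (here refl) = min≤⊤ (f x) (map f xs)
  minOver≤ f (x ∷ xs) _ (there y∈)  = All.lookup (min≤xs (f x) (map f xs)) (∈-map⁺ f y∈)

minvdeg-MU : ∀ k → UpperBound (minvdegs (MU [δ= k ])) (N k)
minvdeg-MU k (F , (mu , δ≡k) , n>0 , refl)
  with degreeBound Fin._≟_ (n F) refl (DecUnique.deduplicate-! ℕ._≟_ _) (MU⇒minUnsat {F} mu) (vars-occur F)
... | n<c , bound with find (bound n>0)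
... | v , v∈ , d≤ = minvdeg≤ F n>0 v∈
  (subst (λ m → vdeg F v ≤ N m) c∸n≡k (≤-trans (vdeg≤deg F v)
    (subst (λ m → deg Fin._≟_ (allFin (c F)) (matrix (clauses F)) v ≤ N (m ∸ n F))
      (length-tabulate {n = c F} id) d≤)))
  where
  -- Positive deficiency makes truncated subtraction agree with the integer `δ F`.
  c∸n≡k : c F ∸ n F ≡ k
  c∸n≡k = ℤ.+-injective (trans (sym (trans (ℤ.m-n≡m⊖n (c F) (n F))
    (ℤ.⊖-≥ (ℕ.<⇒≤ (subst (n F <_) (length-tabulate {n = c F} id) n<c))))) δ≡k)

-- Unsatisfiable hitting clause-sets

-- This assignment falsifies every literal of C, so it satisfies every clause clashing with C.
falsifier : Clause → Assignment
falsifier C v = does (neg v ∈? literals C)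

eval-falsifier : ∀ C {x} → x ∈ literals C → eval (falsifier C) x ≡ false
eval-falsifier C {pos v} x∈ = dec-false (neg v ∈? literals C) (clashFree C x∈)
eval-falsifier C {neg v} x∈ = cong not (dec-true (neg v ∈? literals C) x∈)

-- Hitting concerns only clauses that differ as sets, so the remaining clauses must differ from `C`
-- in that sense.
unique-─ : ∀ {Cs C} → Distinct.Unique clauseSetoid Cs → (C∈ : C ∈ Cs) → All (λ D → ¬ (C ≈ᶜ D)) (Cs ─ C∈)
unique-─ (C≉ ∷ _) (here refl) = C≉
unique-─ {D ∷ _} {C} (D≉ ∷ u) (there C∈)  =
  (λ C≈D → All.lookup D≉ C∈ (Setoid.sym clauseSetoid {C} {D} C≈D)) ∷ unique-─ u C∈

UHIT⇒MU : ∀ {F} → UHIT F → MU F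
UHIT⇒MU {F} (us , hit) = us , λ {C} C∈F → falsifier C ,
  All.zipWith (λ { (C≉D , D∈F) → case hit C∈F D∈F C≉D of λ where
      (x , x∈C , x̄∈D) → lose x̄∈D (trans (eval-complement (falsifier C) x) (cong not (eval-falsifier C x∈C))) })
    (unique-─ (unique F) C∈F , ─⁺ C∈F (All.tabulate id))

-- Concrete hitting clause-sets checked by computation

Clash : Clause → Clause → Set
Clash C D = Any (λ x → complement x ∈ literals D) (literals C)

clash? : ∀ C D → Dec (Clash C D)
clash? C D = any? (λ x → complement x ∈? literals D) (literals C)

-- If they agreed as sets, `C` would contain complementary literals. Thus pairwise clashes also
-- prove that a list has no repetitions.
clash⇒≉ : ∀ {C D} → Clash C D → ¬ (C ≈ᶜ D)
clash⇒≉ {C} clash C≈D with find clash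
... | x , x∈C , x̄∈D = clashFree C x∈C (Equivalence.from C≈D x̄∈D)

complement-involutive : ∀ x → complement (complement x) ≡ x
complement-involutive (pos v) = refl
complement-involutive (neg v) = refl

clauseList : (xss : List (List Literal)) → All (λ xs → All (λ x → complement x ∉ xs) xs) xss → List Clause
clauseList _ = All.reduce λ {xs} free → record { literals = xs ; clashFree = All.lookup free }

clashFree? : ∀ xss → Dec (All (λ xs → All (λ x → complement x ∉ xs) xs) xss)
clashFree? = All.all? λ xs → All.all? (λ x → complement x ∉? xs) xs

hittingSet : (Cs : List Clause) → AllPairs.AllPairs Clash Cs → ClauseSet
hittingSet Cs clashes = record { clauses = Cs ; unique = AllPairs.map (λ {C} {D} → clash⇒≉ {C} {D}) clashes }

-- `AllPairs` records each clash in one order only; in the other order the complementary literal is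
-- the witness.
hittingSet-hitting : ∀ Cs clashes → Hitting (hittingSet Cs clashes)
hittingSet-hitting Cs clashes {C} C∈ D∈ C≉D with ∈-AllPairs₂ clashes C∈ D∈
... | inj₁ refl         = contradiction {A = C ≈ᶜ C} (Setoid.refl clauseSetoid {C}) C≉D
... | inj₂ (inj₁ clash) = find clash
... | inj₂ (inj₂ clash) with find clash
... | x , x∈D , x̄∈C = complement x , x̄∈C , subst (_∈ _) (sym (complement-involutive x)) x∈D

satisfied? : ∀ Cs φ → Dec (All (φ satisfies_) Cs)
satisfied? Cs φ = All.all? (λ C → any? (λ x → eval φ x Bool.≟ true) (literals C)) Cs

extend : ∀ {m} → Vec Bool m → Assignment
extend []       _       = false
extend (b ∷ _)  zero    = b
extend (_ ∷ bs) (suc v) = extend bs v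

restrict : ∀ m → Assignment → Vec Bool m
restrict zero    _ = []
restrict (suc m) φ = φ 0 ∷ restrict m (φ ∘ suc)

refuted : ∀ m → (Vec Bool m → Bool) → Bool
refuted zero    f = not (f [])
refuted (suc m) f = refuted m (f ∘ (true ∷_)) ∧ refuted m (f ∘ (false ∷_))

refuted-sound : ∀ {m f} → refuted m f ≡ true → ∀ bs → f bs ≡ false
refuted-sound {zero}      eq []           = Bool.not-injective eq
refuted-sound {suc m} {f} eq (true ∷ bs)  = refuted-sound {m} (Bool.∧-conicalˡ _ _ eq) bs
refuted-sound {suc m} {f} eq (false ∷ bs) =
  refuted-sound {m} (Bool.∧-conicalʳ (refuted m (f ∘ (true ∷_))) _ eq) bs

-- The first hypothesis says that only the first `m` variables matter. For a concrete list over them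
-- both sides normalise to the same Boolean expression, so `refl` proves it, and the second is an
-- evaluated truth table.
unsatisfiable-by-table : ∀ m {Cs} →
  (∀ φ → does (satisfied? Cs φ) ≡ does (satisfied? Cs (extend (restrict m φ)))) →
  refuted m (λ bs → does (satisfied? Cs (extend bs))) ≡ true → Unsatisfiable Cs
unsatisfiable-by-table m {Cs} local ref (φ , sat) with begin
    true                                                ≡⟨ dec-true (satisfied? Cs φ) sat ⟨
    does (satisfied? Cs φ)                              ≡⟨ local φ ⟩
    does (satisfied? Cs (extend (restrict m φ)))        ≡⟨ refuted-sound {m} ref (restrict m φ) ⟩
    false                                               ∎
  where open ≡-Reasoning
... | ()

-- The variables are those below `m`. Each occurs in all 2^m clauses, so m = 1, 2, 3 give
-- deficiencies 1, 2, 5 and degrees 2, 4, 8.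
cube : ℕ → List (List Literal)
cube zero    = [] ∷ []
cube (suc m) = map (pos m ∷_) (cube m) ++ map (neg m ∷_) (cube m)

attained : ∀ m xss {free : True (clashFree? xss)} → let Cs = clauseList xss (toWitness free) in
  {clashes : True (AllPairs.allPairs? clash? Cs)} → let F = hittingSet Cs (toWitness clashes) in
  (∀ φ → does (satisfied? Cs φ) ≡ does (satisfied? Cs (extend (restrict m φ)))) →
  refuted m (λ bs → does (satisfied? Cs (extend bs))) ≡ true →
  (n>0 : 0 < n F) → ∀ {k d} → δ F ≡ + k → minvdeg F n>0 ≡ d → minvdegs (UHIT [δ= k ]) d
attained m xss {free} {clashes} local ref n>0 δ≡k eq =
  hittingSet Cs (toWitness clashes) ,
  ((unsatisfiable-by-table m local ref , hittingSet-hitting Cs (toWitness clashes)) , δ≡k) , n>0 , eq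
  where
  Cs = clauseList xss (toWitness free)

-- For k = 3, 4 some clauses of the 3-dimensional cube are resolved in pairs: each resolution lowers
-- the deficiency by one and all degrees by one, that of the resolved variable by two.
extremal : ∀ k → 1 ≤ k → k ≤ 5 → minvdegs (UHIT [δ= k ]) (N k)
extremal 1 _ _ = attained 1 (cube 1) (λ _ → refl) refl (s≤s z≤n) refl refl
extremal 2 _ _ = attained 2 (cube 2) (λ _ → refl) refl (s≤s z≤n) refl refl
-- The two resolutions are on different variables, 0 and 1; two on the same variable would leave it
-- with degree 4 instead of 5.
extremal 3 _ _ = attained 3
  ((pos 2 ∷ pos 1 ∷ []) ∷ (pos 2 ∷ neg 1 ∷ pos 0 ∷ []) ∷ (pos 2 ∷ neg 1 ∷ neg 0 ∷ []) ∷
   (neg 2 ∷ pos 0 ∷ []) ∷ (neg 2 ∷ pos 1 ∷ neg 0 ∷ []) ∷ (neg 2 ∷ neg 1 ∷ neg 0 ∷ []) ∷ [])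
  (λ _ → refl) refl (s≤s z≤n) refl refl
extremal 4 _ _ = attained 3 ((pos 2 ∷ pos 1 ∷ []) ∷ drop 2 (cube 3)) (λ _ → refl) refl (s≤s z≤n) refl refl
extremal 5 _ _ = attained 3 (cube 3) (λ _ → refl) refl (s≤s z≤n) refl refl
extremal (suc (suc (suc (suc (suc (suc _)))))) _ (s≤s (s≤s (s≤s (s≤s (s≤s ())))))

theorem14p1 : (k : ℕ) → 1 ≤ k → k ≤ 5 →
    (minvdeg[ MU [δ= k ] ]≡ N k) × (minvdeg[ UHIT [δ= k ] ]≡ N k)
theorem14p1 k 1≤k k≤5 =
  -- The inclusion of `UHIT` in `MU` carries the examples up to `MU` and the upper bound down to
  -- `UHIT`.
  (minvdeg-MU k , λ bounded → bounded (UHIT⊆MU (extremal k 1≤k k≤5))) ,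
  (minvdeg-MU k ∘ UHIT⊆MU , λ bounded → bounded (extremal k 1≤k k≤5))
  where
  UHIT⊆MU : ∀ {m} → minvdegs (UHIT [δ= k ]) m → minvdegs (MU [δ= k ]) m
  UHIT⊆MU (F , (uhit , δ≡k) , rest) = F , (UHIT⇒MU {F} uhit , δ≡k) , rest
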